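{- Let $a$ and $b$ be positive integers. There exists a graph $G$ with $\gamma^{LD}(G)=a$ and $\gamma^{DLD}(G)=b$ if and only if $$0\le b-a\le 2^a-1-\binom{a}{\lceil a/2\rceil}.$$
   Context: Graphs are finite, simple and undirected, and need not be connected. For a vertex $u$, $N(u)$ is its set of neighbours and $N[u]=N(u)\cup\{u\}$. A code is a non-empty subset $C$ of the vertex set $V$; $I(C;u)=N[u]\cap C$. A code $C$ is locating-dominating if for all distinct $u,v\in V\setminus C$ we have $I(C;u)\neq\emptyset$ and $I(C;u)\ne I(C;v)$. A code $C$ is solid-locating-dominating if $I(C;u)\ne\emptyset$ for every $u\in V\setminus C$ and $I(C;u)\not\subseteq I(C;v)$ for all distinct $u,v\in V\setminus C$. $\gamma^{LD}(G)$ and $\gamma^{DLD}(G)$ are the minimum sizes of a locating-dominating and a solid-locating-dominating code in $G$.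
   Formalization: In a locating-dominating code, I(C;u)≠∅ is required for every u outside C, also when V∖C has only one vertex; read literally, the definition over distinct pairs lets two isolated vertices have parameters 1 and 2, which violates the bound. -}

module Defs where

open import Data.Bool.Base using (Bool; false)
open import Data.Fin.Base using (Fin)
open import Data.Fin.Subset using (Subset; _∉_; _⊈_; _∪_; _∩_; ⁅_⁆; ∣_∣; Nonempty)
open import Data.Nat.Base using (ℕ; _≤_)
open import Data.Product.Base using (_×_; ∃-syntax)
open import Data.Vec.Base using (tabulate)
open import Relation.Binary.PropositionalEquality.Core using (_≡_; _≢_)

record Graph (n : ℕ) : Set where
  field
    adj      : Fin n → Fin n → Bool
    adj-sym  : ∀ u v → adj u v ≡ adj v u
    loopless : ∀ u → adj u u ≡ false

module _ {n : ℕ} (G : Graph n) where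
  open Graph G

  N : Fin n → Subset n
  N u = tabulate (adj u)

  N[_] : Fin n → Subset n
  N[ u ] = N u ∪ ⁅ u ⁆

  I : Subset n → Fin n → Subset n
  I C u = N[ u ] ∩ C

  record IsLocatingDominating (C : Subset n) : Set where
    field
      nonempty   : Nonempty C
      dominating : ∀ {u} → u ∉ C → Nonempty (I C u)
      locating   : ∀ {u v} → u ∉ C → v ∉ C → u ≢ v → I C u ≢ I C v

  record IsSolidLocatingDominating (C : Subset n) : Set where
    field
      nonempty       : Nonempty C
      dominating     : ∀ {u} → u ∉ C → Nonempty (I C u)
      solid-locating : ∀ {u v} → u ∉ C → v ∉ C → u ≢ v → I C u ⊈ I C v

IsMinimumSize : ∀ {n} → (Subset n → Set) → ℕ → Set
IsMinimumSize P k = (∃[ C ] P C × ∣ C ∣ ≡ k) × (∀ C → P C → k ≤ ∣ C ∣)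

-- The minimum sizes are relations between a graph and a number, since the
-- graph on no vertices has no (non-empty) code at all.
IsγLD : ∀ {n} → Graph n → ℕ → Set
IsγLD G k = IsMinimumSize (IsLocatingDominating G) k

IsγDLD : ∀ {n} → Graph n → ℕ → Set
IsγDLD G k = IsMinimumSize (IsSolidLocatingDominating G) k

{-# OPTIONS --safe #-}

-- Upper bound. Let S be an optimal locating-dominating code, of size a. The vertices outside S have
-- distinct non-empty traces on S, and those with a trace of size ⌈a/2⌉ have pairwise incomparable
-- ones. Adding all the other vertices to S gives a solid code, and these have at most
-- 2^a - 1 - (a C ⌈a/2⌉) possible traces.
--
-- Construction. In the bipartite incidence graph between [a] and a family of non-empty subsets of [a]
-- that has all the singletons, every singleton is a pendant vertex, so γLD = a. With the singletons
-- only, γDLD = a. With all non-empty subsets, Sperner's theorem bounds the complement of a solid code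
-- by a C ⌈a/2⌉, which is the extremal value. Adding one member to the family raises γDLD by at most
-- one, so everything in between is attained too.
module Submission where

open import Defs
open import Algebra.Bundles using (CommutativeMonoid)
import Algebra.Properties.CommutativeSemigroup as CommutativeSemigroupProperties
open import Data.Bool.Base using (Bool; true; false; _∧_)
open import Data.Bool.Properties using () renaming (_≟_ to _≟ᵇ_)
open import Data.Empty using (⊥-elim)
open import Data.Fin.Base using (Fin; zero; suc; fromℕ<; _↑ˡ_; _↑ʳ_; splitAt)
open import Data.Fin.Properties using (all?; splitAt-↑ˡ; splitAt-↑ʳ; splitAt⁻¹-↑ˡ; splitAt⁻¹-↑ʳ; ↑ˡ-injective; ↑ʳ-injective) renaming (_≟_ to _≟ᶠ_; suc-injective to suc-injectiveᶠ)
open import Data.Fin.Subset using (Subset; inside; outside; _∈_; _∉_; _⊆_; _⊈_; _∩_; _∪_; ∁; ⁅_⁆; ∣_∣; ⊤; ⊥; Nonempty)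
open import Data.Fin.Subset.Properties
import Data.Integer.Base as ℤ
import Data.Integer.Properties as ℤₚ
open import Data.Integer.Tactic.RingSolver using (solve-∀)
open import Data.List.Base as List using (List; []; _∷_; [_]; _++_; length; lookup; filter; concat; concatMap; allFin)
import Data.List.Membership.DecPropositional as DecMembership
open import Data.List.Membership.Propositional using (find) renaming (_∈_ to _∈ˡ_)
import Data.List.Membership.Propositional.Properties as ∈ˡ
import Data.List.Properties as Listₚ
open import Data.List.Relation.Binary.Permutation.Propositional using (_↭_; ↭-refl; ↭-sym; ↭-trans; ↭-reflexive; swap; module PermutationReasoning)
open import Data.List.Relation.Binary.Permutation.Propositional.Properties as ↭ₚ using (↭-length; filter-↭; shift)
open import Data.List.Relation.Unary.All as All using (All; []; _∷_)
import Data.List.Relation.Unary.All.Properties as Allₚ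
open import Data.List.Relation.Unary.AllPairs using ([]; _∷_)
open import Data.List.Relation.Unary.Any using (Any; here; there; index)
open import Data.List.Relation.Unary.Any.Properties using (lookup-index)
open import Data.List.Relation.Unary.Unique.Propositional using (Unique)
import Data.List.Relation.Unary.Unique.Propositional.Properties as Uniqueₚ
open import Data.Nat.Base using (ℕ; _<_; _^_; ⌈_/2⌉)
open import Data.Nat.Combinatorics using (_C_; nCn≡1; nCk≡nC[n∸k]; nCk+nC[k+1]≡[n+1]C[k+1])
open import Data.Nat.Properties
open import Data.Product.Base using (_×_; _,_; proj₁; proj₂; ∃-syntax)
open import Data.Sum.Base using (_⊎_; inj₁; inj₂; [_,_]′)
open import Data.Vec.Base as Vec using ([]; _∷_; here; there; tabulate)
open import Data.Vec.Properties using (lookup⇒[]=; []=⇒lookup; lookup∘tabulate; lookup-++ˡ; lookup-++ʳ; ∷-injectiveʳ; ∷-injectiveˡ) renaming (≡-dec to Vec-≡-dec)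
open import Function.Base using (id; _∘_; case_of_)
open import Function.Bundles using (_⇔_; mk⇔)
open import Function.Properties.Equivalence using () renaming (trans to ⇔-trans)
open import Level using (Level)
open import Relation.Binary.PropositionalEquality using (_≡_; _≢_; refl; sym; trans; cong; cong₂; subst; module ≡-Reasoning)
open import Relation.Nullary using (¬_; yes; no; does; ¬?; contradiction)
open import Relation.Nullary.Decidable using (dec-true; map′; _×-dec_; _→-dec_)
open import Relation.Unary using (Pred; Decidable)

module Combinatorics where

  open import Data.Fin.Subset using (_-_)
  open import Data.Nat.Base hiding (∣_-_∣)

  private
    variable
      ℓ : Level
      A B : Set ℓ
      m n : ℕ

  -- Counting by injections into subsets and lists.

  -- The map takes a membership proof, so it may be defined on `p` alone. The image of the first
  -- element is removed from `q`, which makes `q` smaller; injectivity keeps the remaining images in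
  -- what is left.
  ∣p∣≤∣q∣-injection : (p : Subset m) (q : Subset n)
    (f : ∀ {x} → x ∈ p → Fin n) → (∀ {x} (h : x ∈ p) → f h ∈ q) →
    (∀ {x y} (h : x ∈ p) (h′ : y ∈ p) → f h ≡ f h′ → x ≡ y) → ∣ p ∣ ≤ ∣ q ∣
  ∣p∣≤∣q∣-injection []            q f f∈q inj = z≤n
  ∣p∣≤∣q∣-injection (outside ∷ p) q f f∈q inj =
    ∣p∣≤∣q∣-injection p q (f ∘ there) (f∈q ∘ there)
      (λ h h′ eq → suc-injectiveᶠ (inj (there h) (there h′) eq))
  ∣p∣≤∣q∣-injection (inside  ∷ p) q f f∈q inj = ≤-<-trans
    (∣p∣≤∣q∣-injection p (q - f here) (f ∘ there)
      (λ h → x∈p∧x≢y⇒x∈p-y (f∈q (there h)) λ eq → case inj (there h) here eq of λ ())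
      (λ h h′ eq → suc-injectiveᶠ (inj (there h) (there h′) eq)))
    (x∈p⇒∣p-x∣<∣p∣ (f∈q here))

  -- Each `x` goes to the position at which `f x` was found in `xs`. Looking up that position gives
  -- back `f x`, so equal positions mean equal values.
  ∣p∣≤length-injection : (p : Subset m) (xs : List A)
    (f : ∀ {x} → x ∈ p → A) → (∀ {x} (h : x ∈ p) → f h ∈ˡ xs) →
    (∀ {x y} (h : x ∈ p) (h′ : y ∈ p) → f h ≡ f h′ → x ≡ y) → ∣ p ∣ ≤ length xs
  ∣p∣≤length-injection p xs f f∈xs inj = subst (∣ p ∣ ≤_) (∣⊤∣≡n (length xs))
    (∣p∣≤∣q∣-injection p ⊤ (index ∘ f∈xs) (λ _ → ∈⊤) λ h h′ eq → inj h h′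
      (trans (lookup-index (f∈xs h))
        (trans (cong (lookup xs) eq) (sym (lookup-index (f∈xs h′))))))

  lookup-injective : {xs : List A} → Unique xs → ∀ i j → lookup xs i ≡ lookup xs j → i ≡ j
  lookup-injective (_  ∷ _) zero    zero    _  = refl
  lookup-injective (x∉ ∷ _) zero    (suc j) eq = contradiction eq (All.lookup x∉ (∈ˡ.∈-lookup j))
  lookup-injective (x∉ ∷ _) (suc i) zero    eq = contradiction (sym eq) (All.lookup x∉ (∈ˡ.∈-lookup i))
  lookup-injective (_  ∷ u) (suc i) (suc j) eq = cong suc (lookup-injective u i j eq)

  Unique-length-≤ : {xs ys : List A} → Unique xs → (∀ {x} → x ∈ˡ xs → x ∈ˡ ys) → length xs ≤ length ys
  Unique-length-≤ {xs = xs} {ys} u xs⊆ys = subst (_≤ length ys) (∣⊤∣≡n (length xs))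
    (∣p∣≤length-injection ⊤ ys (λ {i} _ → lookup xs i) (λ {i} _ → xs⊆ys (∈ˡ.∈-lookup i))
      λ {i} {j} _ _ → lookup-injective u i j)

  length-filter-map : ∀ {P : Pred B ℓ} (P? : Decidable P) (f : A → B) xs →
    length (filter P? (List.map f xs)) ≡ length (filter (P? ∘ f) xs)
  length-filter-map P? f []       = refl
  length-filter-map P? f (x ∷ xs) with does (P? (f x))
  ... | true  = cong suc (length-filter-map P? f xs)
  ... | false = length-filter-map P? f xs

  length-filter-∁ : ∀ {P : Pred A ℓ} (P? : Decidable P) xs →
    length (filter (¬? ∘ P?) xs) + length (filter P? xs) ≡ length xs
  length-filter-∁ P? []       = refl
  length-filter-∁ P? (x ∷ xs) with does (P? x)
  ... | true  = trans (+-suc _ _) (cong suc (length-filter-∁ P? xs))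
  ... | false = cong suc (length-filter-∁ P? xs)

  -- The list of all subsets and its layers.

  subsets : ∀ n → List (Subset n)
  subsets zero    = [ [] ]
  subsets (suc n) = List.map (outside ∷_) (subsets n) ++ List.map (inside ∷_) (subsets n)

  ∈-subsets : (p : Subset n) → p ∈ˡ subsets n
  ∈-subsets []            = here refl
  ∈-subsets (outside ∷ p) = ∈ˡ.∈-++⁺ˡ (∈ˡ.∈-map⁺ _ (∈-subsets p))
  ∈-subsets (inside  ∷ p) = ∈ˡ.∈-++⁺ʳ _ (∈ˡ.∈-map⁺ _ (∈-subsets p))

  subsets-unique : ∀ n → Unique (subsets n)
  subsets-unique zero    = [] ∷ []
  subsets-unique (suc n) = Uniqueₚ.++⁺
    (Uniqueₚ.map⁺ ∷-injectiveʳ (subsets-unique n))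
    (Uniqueₚ.map⁺ ∷-injectiveʳ (subsets-unique n))
    λ (out , inn) → case ∈ˡ.∈-map⁻ _ out , ∈ˡ.∈-map⁻ _ inn of
      λ { ((_ , _ , refl) , (_ , _ , ())) }

  length-subsets : ∀ n → length (subsets n) ≡ 2 ^ n
  length-subsets zero    = refl
  length-subsets (suc n) = begin
    length (List.map (outside ∷_) (subsets n) ++ List.map (inside ∷_) (subsets n))
      ≡⟨ Listₚ.length-++ (List.map (outside ∷_) (subsets n)) ⟩
    length (List.map (outside ∷_) (subsets n)) + length (List.map (inside ∷_) (subsets n))
      ≡⟨ cong₂ _+_ (half outside) (trans (half inside) (sym (+-identityʳ _))) ⟩
    2 ^ suc n ∎
    where
    open ≡-Reasoning
    half : ∀ s → length (List.map (s ∷_) (subsets n)) ≡ 2 ^ n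
    half s = trans (Listₚ.length-map _ (subsets n)) (length-subsets n)

  hasSize? : ∀ k → Decidable (λ (p : Subset n) → ∣ p ∣ ≡ k)
  hasSize? k p = ∣ p ∣ ≟ k

  -- Pascal's rule: the subsets of size `k` are split by whether they contain the first element.
  length-layer : ∀ n k → length (filter (hasSize? k) (subsets n)) ≡ n C k
  length-layer zero    zero    = refl
  length-layer zero    (suc k) = refl
  length-layer (suc n) k       = trans split (layers k)
    where
    open ≡-Reasoning
    outs ins : List (Subset (suc n))
    outs = List.map (outside ∷_) (subsets n)
    ins  = List.map (inside ∷_) (subsets n)

    split : length (filter (hasSize? k) (outs ++ ins)) ≡
            n C k + length (filter (hasSize? k ∘ (inside ∷_)) (subsets n))
    split = begin
      length (filter (hasSize? k) (outs ++ ins))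
        ≡⟨ cong length (Listₚ.filter-++ (hasSize? k) outs ins) ⟩
      length (filter (hasSize? k) outs ++ filter (hasSize? k) ins)
        ≡⟨ Listₚ.length-++ (filter (hasSize? k) outs) ⟩
      length (filter (hasSize? k) outs) + length (filter (hasSize? k) ins)
        ≡⟨ cong₂ _+_ (trans (length-filter-map (hasSize? k) (outside ∷_) (subsets n)) (length-layer n k))
                     (length-filter-map (hasSize? k) (inside ∷_) (subsets n)) ⟩
      n C k + length (filter (hasSize? k ∘ (inside ∷_)) (subsets n)) ∎

    nC0≡1 : ∀ m → m C 0 ≡ 1
    nC0≡1 m = trans (nCk≡nC[n∸k] {0} {m} z≤n) (nCn≡1 m)

    layers : ∀ k → n C k + length (filter (hasSize? k ∘ (inside ∷_)) (subsets n)) ≡ suc n C k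
    -- A subset that contains the first element never has size 0, so the second summand vanishes.
    layers zero    = begin
      n C 0 + length (filter (hasSize? 0 ∘ (inside ∷_)) (subsets n))
        ≡⟨ cong₂ _+_ (nC0≡1 n) (cong length
             (Listₚ.filter-none (hasSize? 0 ∘ (inside ∷_)) (All.universal (λ _ ()) (subsets n)))) ⟩
      1
        ≡⟨ nC0≡1 (suc n) ⟨
      suc n C 0 ∎
    layers (suc k) = begin
      n C suc k + length (filter (hasSize? (suc k) ∘ (inside ∷_)) (subsets n))
        ≡⟨ cong (λ xs → n C suc k + length xs)
             (Listₚ.filter-≐ (hasSize? (suc k) ∘ (inside ∷_)) (hasSize? k) (suc-injective , cong suc) (subsets n)) ⟩
      n C suc k + length (filter (hasSize? k) (subsets n))
        ≡⟨ cong (n C suc k +_) (length-layer n k) ⟩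
      n C suc k + n C k
        ≡⟨ +-comm (n C suc k) (n C k) ⟩
      n C k + n C suc k
        ≡⟨ nCk+nC[k+1]≡[n+1]C[k+1] n k ⟩
      suc n C suc k ∎

  -- Symmetric chain decomposition and Sperner's theorem.

  -- The de Bruijn–Tengbergen–Kruyswijk step, on chains listed from the top down.
  extend : List (Subset n) → List (List (Subset (suc n)))
  extend []           = []
  extend (p ∷ [])     = ((inside ∷ p) ∷ (outside ∷ p) ∷ []) ∷ []
  extend (p ∷ q ∷ ps) = ((inside ∷ p) ∷ List.map (outside ∷_) (p ∷ q ∷ ps))
                      ∷ List.map (inside ∷_) (q ∷ ps) ∷ []

  chains : ∀ n → List (List (Subset n))
  chains zero    = [ [ [] ] ]
  chains (suc n) = concatMap extend (chains n)

  -- In a chain of two or more members only `inside ∷ p` is out of order; `shift` moves it behind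
  -- the outside copies.
  concat-extend : (ps : List (Subset n)) →
    concat (extend ps) ↭ List.map (outside ∷_) ps ++ List.map (inside ∷_) ps
  concat-extend []           = ↭-refl
  concat-extend (p ∷ [])     = swap _ _ ↭-refl
  concat-extend (p ∷ q ∷ ps) = ↭-trans
    (↭-reflexive (cong (((inside ∷ p) ∷ List.map (outside ∷_) (p ∷ q ∷ ps)) ++_) (Listₚ.++-identityʳ _)))
    (↭-sym (shift (inside ∷ p) (List.map (outside ∷_) (p ∷ q ∷ ps)) _))

  concat-concatMap-extend : (pss : List (List (Subset n))) →
    concat (concatMap extend pss) ↭ List.map (outside ∷_) (concat pss) ++ List.map (inside ∷_) (concat pss)
  concat-concatMap-extend []         = ↭-refl
  concat-concatMap-extend (ps ∷ pss) = begin
    concat (extend ps ++ concatMap extend pss)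
      ≡⟨ Listₚ.concat-++ (extend ps) (concatMap extend pss) ⟨
    concat (extend ps) ++ concat (concatMap extend pss)
      ↭⟨ ↭ₚ.++⁺ (concat-extend ps) (concat-concatMap-extend pss) ⟩
    (List.map (outside ∷_) ps ++ List.map (inside ∷_) ps) ++
    (List.map (outside ∷_) (concat pss) ++ List.map (inside ∷_) (concat pss))
      ↭⟨ interchange (List.map (outside ∷_) ps) _ _ _ ⟩
    (List.map (outside ∷_) ps ++ List.map (outside ∷_) (concat pss)) ++
    (List.map (inside ∷_) ps ++ List.map (inside ∷_) (concat pss))
      ≡⟨ cong₂ _++_ (Listₚ.map-++ _ ps (concat pss)) (Listₚ.map-++ _ ps (concat pss)) ⟨
    List.map (outside ∷_) (ps ++ concat pss) ++ List.map (inside ∷_) (ps ++ concat pss) ∎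
    where
    open PermutationReasoning
    open CommutativeSemigroupProperties
      (CommutativeMonoid.commutativeSemigroup ↭ₚ.++-commutativeMonoid) using (interchange)

  concat-chains : ∀ n → concat (chains n) ↭ subsets n
  concat-chains zero    = ↭-refl
  concat-chains (suc n) = ↭-trans (concat-concatMap-extend (chains n))
    (↭ₚ.++⁺ (↭ₚ.map⁺ _ (concat-chains n)) (↭ₚ.map⁺ _ (concat-chains n)))

  -- A saturated chain: `h` and `l` are the sizes of its first and last members, and sizes drop by
  -- exactly one at each step, so no size in between is skipped.
  data Saturated {n} (l : ℕ) : ℕ → List (Subset n) → Set where
    bottom : ∀ {p} → ∣ p ∣ ≡ l → Saturated l l (p ∷ [])
    top    : ∀ {h p q ps} → ∣ p ∣ ≡ suc h → q ⊆ p → Saturated l h (q ∷ ps) → Saturated l (suc h) (p ∷ q ∷ ps)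

  module _ {l : ℕ} where

    map-outside : ∀ {h} {ps : List (Subset n)} → Saturated l h ps → Saturated l h (List.map (outside ∷_) ps)
    map-outside (bottom eq)    = bottom eq
    map-outside (top eq q⊆p s) = top eq (s⊆s q⊆p) (map-outside s)

    map-inside : ∀ {h} {ps : List (Subset n)} → Saturated l h ps → Saturated (suc l) (suc h) (List.map (inside ∷_) ps)
    map-inside (bottom eq)    = bottom (cong suc eq)
    map-inside (top eq q⊆p s) = top (cong suc eq) (s⊆s q⊆p) (map-inside s)

    l≤h : ∀ {h} {ps : List (Subset n)} → Saturated l h ps → l ≤ h
    l≤h (bottom _)  = ≤-refl
    l≤h (top _ _ s) = m≤n⇒m≤1+n (l≤h s)

    meets-layer : ∀ {h k} {ps : List (Subset n)} → Saturated l h ps → l ≤ k → k ≤ h → Any (λ p → ∣ p ∣ ≡ k) ps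
    meets-layer (bottom eq)  l≤k k≤h = here (trans eq (≤-antisym l≤k k≤h))
    meets-layer (top eq _ s) l≤k k≤h with m≤n⇒m<n∨m≡n k≤h
    ... | inj₁ k<1+h = there (meets-layer s l≤k (s≤s⁻¹ k<1+h))
    ... | inj₂ refl  = here eq

    ⊆-top : ∀ {h p r} {ps : List (Subset n)} → Saturated l h (p ∷ ps) → r ∈ˡ p ∷ ps → r ⊆ p
    ⊆-top s              (here refl) = ⊆-refl
    ⊆-top (bottom _)     (there ())
    ⊆-top (top _ q⊆p s) (there r∈)  = ⊆-trans (⊆-top s r∈) q⊆p

    -- Inclusions are stored between neighbours only. Once one of the two members is at the head, it
    -- contains the other by transitivity.
    comparable : ∀ {h p q} {ps : List (Subset n)} → Saturated l h ps → p ∈ˡ ps → q ∈ˡ ps → p ⊆ q ⊎ q ⊆ p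
    comparable {ps = _ ∷ _} s (here refl) q∈          = inj₂ (⊆-top s q∈)
    comparable {ps = _ ∷ _} s p∈          (here refl) = inj₁ (⊆-top s p∈)
    comparable (top _ _ s) (there p∈)  (there q∈)  = comparable s p∈ q∈
    comparable (bottom _)  (there ())  (there _)

  -- The equation `l + h ≡ n` centres the chain on the middle rank, which is what makes it meet the
  -- middle layer.
  Symmetric : List (Subset n) → Set
  Symmetric {n} ps = ∃[ l ] ∃[ h ] l + h ≡ n × Saturated l h ps

  -- The first new chain keeps its bottom and gains one size at the top. The second loses the old
  -- top and then gains one element throughout, so `l` rises by one and `h` stays. Both sums grow by
  -- one. From a one-member chain the second would be empty, and `extend` omits it.
  extend-symmetric : {ps : List (Subset n)} → Symmetric ps → All Symmetric (extend ps)
  extend-symmetric (l , _ , eq , bottom size) =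
    (l , suc l , trans (+-suc l l) (cong suc eq) , top (cong suc size) (out⊆ ⊆-refl) (bottom size)) ∷ []
  extend-symmetric (l , suc h , eq , s@(top size _ s′)) =
      (l , suc (suc h) , trans (+-suc l _) (cong suc eq) , top (cong suc size) (out⊆ ⊆-refl) (map-outside s))
    ∷ (suc l , suc h , cong suc eq , map-inside s′)
    ∷ []

  chains-symmetric : ∀ n → All Symmetric (chains n)
  chains-symmetric zero    = (0 , 0 , refl , bottom refl) ∷ []
  chains-symmetric (suc n) = Allₚ.concat⁺ (Allₚ.map⁺ (All.map extend-symmetric (chains-symmetric n)))

  length≤length-filter-concat : ∀ {P : Pred A ℓ} (P? : Decidable P) {xss : List (List A)} →
    All (Any P) xss → length xss ≤ length (filter P? (concat xss))
  length≤length-filter-concat P? [] = z≤n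
  length≤length-filter-concat P? {xs ∷ xss} (any ∷ anys) = begin
    suc (length xss)
      ≤⟨ +-mono-≤ (positive any) (length≤length-filter-concat P? anys) ⟩
    length (filter P? xs) + length (filter P? (concat xss))
      ≡⟨ Listₚ.length-++ (filter P? xs) ⟨
    length (filter P? xs ++ filter P? (concat xss))
      ≡⟨ cong length (Listₚ.filter-++ P? xs (concat xss)) ⟨
    length (filter P? (xs ++ concat xss)) ∎
    where
    open ≤-Reasoning
    positive : ∀ {xs} → Any _ xs → 1 ≤ length (filter P? xs)
    positive any with _ , x∈xs , px ← find any = ∈ˡ.∈-length (∈ˡ.∈-filter⁺ P? x∈xs px)

  -- The chains partition the subsets and each of them meets the middle layer, so there are no more
  -- chains than subsets in that layer.
  length-chains : ∀ n → length (chains n) ≤ n C ⌈ n /2⌉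
  length-chains n = begin
    length (chains n)
      ≤⟨ length≤length-filter-concat (hasSize? ⌈ n /2⌉) (All.map middle (chains-symmetric n)) ⟩
    length (filter (hasSize? ⌈ n /2⌉) (concat (chains n)))
      ≡⟨ ↭-length (filter-↭ (hasSize? ⌈ n /2⌉) (concat-chains n)) ⟩
    length (filter (hasSize? ⌈ n /2⌉) (subsets n))
      ≡⟨ length-layer n ⌈ n /2⌉ ⟩
    n C ⌈ n /2⌉ ∎
    where
    open ≤-Reasoning
    middle : ∀ {ps} → Symmetric ps → Any (λ p → ∣ p ∣ ≡ ⌈ n /2⌉) ps
    -- As `l ≤ h`, half of `l + h` lies between half of `l + l` and half of `h + h`, that is,
    -- between `l` and `h`.
    middle (l , h , refl , s) = meets-layer s
      (≤-trans (≤-reflexive (n≡⌈n+n/2⌉ l)) (⌈n/2⌉-mono (+-monoʳ-≤ l (l≤h s))))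
      (≤-trans (⌈n/2⌉-mono (+-monoˡ-≤ h (l≤h s))) (≤-reflexive (sym (n≡⌈n+n/2⌉ h))))

  -- Two members of one chain are comparable, so choosing a chain through each `f u` is injective on
  -- `s`.
  sperner : (f : Fin m → Subset n) (s : Subset m) →
    (∀ {u v} → u ∈ s → v ∈ s → u ≢ v → f u ⊈ f v) → ∣ s ∣ ≤ n C ⌈ n /2⌉
  sperner {n = n} f s antichain = ≤-trans
    (∣p∣≤length-injection s (chains n) (λ {u} _ → chain u) (λ {u} _ → chain∈ u) injective)
    (length-chains n)
    where
    located : ∀ u → ∃[ ps ] f u ∈ˡ ps × ps ∈ˡ chains n
    located u = ∈ˡ.∈-concat⁻′ (chains n) (↭ₚ.∈-resp-↭ (↭-sym (concat-chains n)) (∈-subsets (f u)))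
    chain  = proj₁ ∘ located
    f∈chain = λ u → proj₁ (proj₂ (located u))
    chain∈ = λ u → proj₂ (proj₂ (located u))
    injective : ∀ {u v} → u ∈ s → v ∈ s → chain u ≡ chain v → u ≡ v
    injective {u} {v} u∈s v∈s eq with u ≟ᶠ v
    ... | yes u≡v = u≡v
    ... | no  u≢v with _ , _ , _ , sat ← All.lookup (chains-symmetric n) (chain∈ v)
                  with comparable sat (subst (f u ∈ˡ_) eq (f∈chain u)) (f∈chain v)
    ...   | inj₁ fu⊆fv = ⊥-elim (antichain u∈s v∈s u≢v fu⊆fv)
    ...   | inj₂ fv⊆fu = ⊥-elim (antichain v∈s u∈s (u≢v ∘ sym) fv⊆fu)

module Codes where

  open import Data.Fin.Subset using (_-_)
  open import Data.Nat.Base hiding (∣_-_∣)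
  open Combinatorics

  private
    variable
      ℓ : Level
      a k m n : ℕ

  -- Subsets cut out by a predicate or restricted to a code.

  ∈-tabulate⁺ : {f : Fin n → Bool} {x : Fin n} → f x ≡ true → x ∈ tabulate f
  ∈-tabulate⁺ {f = f} {x} eq = lookup⇒[]= x _ (trans (lookup∘tabulate f x) eq)

  ∈-tabulate⁻ : {f : Fin n → Bool} {x : Fin n} → x ∈ tabulate f → f x ≡ true
  ∈-tabulate⁻ {f = f} {x} x∈ = trans (sym (lookup∘tabulate f x)) ([]=⇒lookup x∈)

  select : {P : Pred (Fin n) ℓ} → Decidable P → Subset n
  select P? = tabulate (does ∘ P?)

  module _ {P : Pred (Fin n) ℓ} (P? : Decidable P) {x : Fin n} where

    ∈-select⁺ : P x → x ∈ select P?
    ∈-select⁺ = ∈-tabulate⁺ ∘ dec-true (P? x)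

    ∈-select⁻ : x ∈ select P? → P x
    ∈-select⁻ x∈ with P? x | ∈-tabulate⁻ x∈
    ... | yes px | _ = px

  ∣p∪q∣≤∣p∣+∣q∣ : (p q : Subset n) → ∣ p ∪ q ∣ ≤ ∣ p ∣ + ∣ q ∣
  ∣p∪q∣≤∣p∣+∣q∣ []            []            = z≤n
  ∣p∪q∣≤∣p∣+∣q∣ (inside  ∷ p) (inside  ∷ q) = s≤s (≤-trans (∣p∪q∣≤∣p∣+∣q∣ p q) (+-monoʳ-≤ ∣ p ∣ (n≤1+n ∣ q ∣)))
  ∣p∪q∣≤∣p∣+∣q∣ (inside  ∷ p) (outside ∷ q) = s≤s (∣p∪q∣≤∣p∣+∣q∣ p q)
  ∣p∪q∣≤∣p∣+∣q∣ (outside ∷ p) (inside  ∷ q) = ≤-trans (s≤s (∣p∪q∣≤∣p∣+∣q∣ p q)) (≤-reflexive (sym (+-suc ∣ p ∣ ∣ q ∣)))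
  ∣p∪q∣≤∣p∣+∣q∣ (outside ∷ p) (outside ∷ q) = ∣p∪q∣≤∣p∣+∣q∣ p q

  p⊆q∧∣p∣≡∣q∣⇒p≡q : {p q : Subset n} → p ⊆ q → ∣ p ∣ ≡ ∣ q ∣ → p ≡ q
  p⊆q∧∣p∣≡∣q∣⇒p≡q {p = p} {q} p⊆q eq = ⊆-antisym p⊆q q⊆p
    where
    q⊆p : q ⊆ p
    q⊆p {x} x∈q with x ∈? p
    ... | yes x∈p = x∈p
    ... | no  x∉p = contradiction eq (<⇒≢ (p⊂q⇒∣p∣<∣q∣ (p⊆q , x , x∈q , x∉p)))

  -- The restriction of a subset to `S`, reindexed by the elements of `S`, so that traces on a code
  -- can be counted among the `2 ^ ∣ S ∣` entries of `subsets ∣ S ∣`.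
  compress : (S : Subset n) → Subset n → Subset ∣ S ∣
  compress []            []      = []
  compress (inside  ∷ S) (s ∷ p) = s ∷ compress S p
  compress (outside ∷ S) (s ∷ p) = compress S p

  ∣compress∣ : (S p : Subset n) → ∣ compress S p ∣ ≡ ∣ p ∩ S ∣
  ∣compress∣ []            []            = refl
  ∣compress∣ (inside  ∷ S) (inside  ∷ p) = cong suc (∣compress∣ S p)
  ∣compress∣ (inside  ∷ S) (outside ∷ p) = ∣compress∣ S p
  ∣compress∣ (outside ∷ S) (inside  ∷ p) = ∣compress∣ S p
  ∣compress∣ (outside ∷ S) (outside ∷ p) = ∣compress∣ S p

  compress-injective : (S p q : Subset n) → compress S p ≡ compress S q → p ∩ S ≡ q ∩ S
  compress-injective []            []            []            _  = refl
  compress-injective (inside  ∷ S) (s ∷ p)       (t ∷ q)       eq =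
    cong₂ _∷_ (cong (_∧ true) (∷-injectiveˡ eq)) (compress-injective S p q (∷-injectiveʳ eq))
  compress-injective (outside ∷ S) (inside  ∷ p) (inside  ∷ q) eq = cong (outside ∷_) (compress-injective S p q eq)
  compress-injective (outside ∷ S) (inside  ∷ p) (outside ∷ q) eq = cong (outside ∷_) (compress-injective S p q eq)
  compress-injective (outside ∷ S) (outside ∷ p) (inside  ∷ q) eq = cong (outside ∷_) (compress-injective S p q eq)
  compress-injective (outside ∷ S) (outside ∷ p) (outside ∷ q) eq = cong (outside ∷_) (compress-injective S p q eq)

  -- Traces of vertices on a code.

  module _ (G : Graph n) where
    open Graph G

    ∈I⁺ : ∀ {S u x} → adj u x ≡ true ⊎ x ≡ u → x ∈ S → x ∈ I G S u
    ∈I⁺ {u = u} near x∈S = x∈p∩q⁺ (x∈p∪q⁺ (closed near) , x∈S)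
      where
      closed : ∀ {x} → adj u x ≡ true ⊎ x ≡ u → x ∈ N G u ⊎ x ∈ ⁅ u ⁆
      closed (inj₁ eq)   = inj₁ (∈-tabulate⁺ eq)
      closed (inj₂ refl) = inj₂ (x∈⁅x⁆ u)

    ∈I⁻ : ∀ {S u x} → x ∈ I G S u → (adj u x ≡ true ⊎ x ≡ u) × x ∈ S
    ∈I⁻ {S} {u} x∈I with x∈N , x∈S ← x∈p∩q⁻ (N[_] G u) S x∈I with x∈p∪q⁻ (N G u) ⁅ u ⁆ x∈N
    ... | inj₁ x∈Nu = inj₁ (∈-tabulate⁻ x∈Nu) , x∈S
    ... | inj₂ x∈u  = inj₂ (x∈⁅y⁆⇒x≡y u x∈u) , x∈S

    I-mono : ∀ {S D u} → S ⊆ D → I G S u ⊆ I G D u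
    I-mono S⊆D x∈I with near , x∈S ← ∈I⁻ x∈I = ∈I⁺ near (S⊆D x∈S)

    -- Whether `x` is near `v` does not depend on the code, so an inclusion of traces on `D`
    -- restricts to the smaller code `S`.
    I-cancel : ∀ {S D u v} → S ⊆ D → I G D u ⊆ I G D v → I G S u ⊆ I G S v
    I-cancel {u = u} S⊆D sub x∈I = ∈I⁺ (proj₁ (∈I⁻ (sub (I-mono {u = u} S⊆D x∈I)))) (proj₂ (∈I⁻ {u = u} x∈I))

    solid⇒locating : ∀ {S} → IsSolidLocatingDominating G S → IsLocatingDominating G S
    solid⇒locating solid = record
      { nonempty   = nonempty
      ; dominating = dominating
      ; locating   = λ u∉ v∉ u≢v eq → solid-locating u∉ v∉ u≢v (⊆-reflexive eq)
      } where open IsSolidLocatingDominating solid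

    -- Decidability lets `descend` search all subsets for a small solid code.
    solid? : Decidable (IsSolidLocatingDominating G)
    solid? S = map′
      (λ (ne , dom , sol) → record
        { nonempty = ne ; dominating = λ {u} → dom u ; solid-locating = λ {u} {v} → sol u v })
      (λ solid → let open IsSolidLocatingDominating solid in
        nonempty , (λ _ → dominating) , (λ _ _ → solid-locating))
      (nonempty? S
        ×-dec all? (λ u → ¬? (u ∈? S) →-dec nonempty? (I G S u))
        ×-dec all? (λ u → all? (λ v → ¬? (u ∈? S) →-dec ¬? (v ∈? S) →-dec ¬? (u ≟ᶠ v)
                →-dec ¬? (I G S u ⊆? I G S v))))

  -- The upper bound.

  module _ {G : Graph n} {S : Subset n} (ld : IsLocatingDominating G S) (k : ℕ) where
    open IsLocatingDominating ld

    offLayer? : Decidable (λ u → u ∉ S × ∣ I G S u ∣ ≢ k)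
    offLayer? u = ¬? (u ∈? S) ×-dec ¬? (∣ I G S u ∣ ≟ k)

    offLayer : Subset n
    offLayer = select offLayer?

    -- The vertices left outside all have traces of size `k` on `S`. An inclusion between two of
    -- these is an equality, which `locating` excludes.
    S∪offLayer-solid : IsSolidLocatingDominating G (S ∪ offLayer)
    S∪offLayer-solid = record
      { nonempty       = let x , x∈S = nonempty in x , p⊆p∪q offLayer x∈S
      ; dominating     = λ u∉D → let x , x∈I = dominating (∉S u∉D) in x , I-mono G (p⊆p∪q offLayer) x∈I
      ; solid-locating = λ {u} {v} u∉D v∉D u≢v sub → locating (∉S u∉D) (∉S v∉D) u≢v
          (p⊆q∧∣p∣≡∣q∣⇒p≡q (I-cancel G {u = u} {v} (p⊆p∪q offLayer) sub) (trans (onLayer u∉D) (sym (onLayer v∉D))))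
      }
      where
      ∉S : ∀ {u} → u ∉ S ∪ offLayer → u ∉ S
      ∉S u∉D u∈S = u∉D (p⊆p∪q offLayer u∈S)

      onLayer : ∀ {u} → u ∉ S ∪ offLayer → ∣ I G S u ∣ ≡ k
      onLayer {u} u∉D with ∣ I G S u ∣ ≟ k
      ... | yes eq = eq
      ... | no  ne = contradiction (q⊆p∪q S offLayer (∈-select⁺ offLayer? (∉S u∉D , ne))) u∉D

    -- The empty set, being the trace of no vertex, is put in as the trace of an additional vertex zero.
    ∣offLayer∣-bound : k ≢ 0 → suc ∣ offLayer ∣ + ∣ S ∣ C k ≤ 2 ^ ∣ S ∣
    ∣offLayer∣-bound k≢0 = begin
      suc ∣ offLayer ∣ + ∣ S ∣ C k
        ≤⟨ +-monoˡ-≤ (∣ S ∣ C k) (∣p∣≤length-injection (inside ∷ offLayer) others (λ {u} _ → trace u) trace∈ injective) ⟩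
      length others + ∣ S ∣ C k
        ≡⟨ cong (length others +_) (length-layer ∣ S ∣ k) ⟨
      length others + length (filter (hasSize? k) (subsets ∣ S ∣))
        ≡⟨ length-filter-∁ (hasSize? k) (subsets ∣ S ∣) ⟩
      length (subsets ∣ S ∣)
        ≡⟨ length-subsets ∣ S ∣ ⟩
      2 ^ ∣ S ∣ ∎
      where
      open ≤-Reasoning
      others : List (Subset ∣ S ∣)
      others = filter (¬? ∘ hasSize? k) (subsets ∣ S ∣)

      trace : Fin (suc n) → Subset ∣ S ∣
      trace zero    = ⊥
      trace (suc u) = compress S (N[_] G u)

      ∣trace∣ : ∀ {u} → u ∈ inside ∷ offLayer → ∣ trace u ∣ ≢ k
      -- The additional trace `⊥` passes the filter because `k` is not 0.
      ∣trace∣ here       eq = k≢0 (trans (sym eq) (∣⊥∣≡0 ∣ S ∣))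
      ∣trace∣ (there u∈) eq = proj₂ (∈-select⁻ offLayer? u∈) (trans (sym (∣compress∣ S _)) eq)

      trace∈ : ∀ {u} → u ∈ inside ∷ offLayer → trace u ∈ˡ others
      trace∈ u∈ = ∈ˡ.∈-filter⁺ (¬? ∘ hasSize? k) (∈-subsets _) (∣trace∣ u∈)

      nonempty-trace : ∀ {u} → u ∈ offLayer → ⊥ ≢ trace (suc u)
      nonempty-trace {u} u∈ eq with x , x∈I ← dominating (proj₁ (∈-select⁻ offLayer? u∈)) =
        -- A trace containing `x` has positive size, whereas `⊥` has size 0.
        n≮0 (subst (suc ∣ I G S u - x ∣ ≤_)
          (trans (sym (∣compress∣ S (N[_] G u))) (trans (cong ∣_∣ (sym eq)) (∣⊥∣≡0 ∣ S ∣)))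
          (x∈p⇒∣p-x∣<∣p∣ x∈I))

      injective : ∀ {u v} → u ∈ inside ∷ offLayer → v ∈ inside ∷ offLayer → trace u ≡ trace v → u ≡ v
      injective here       here       _  = refl
      injective here       (there v∈) eq = contradiction eq (nonempty-trace v∈)
      injective (there u∈) here       eq = contradiction (sym eq) (nonempty-trace u∈)
      injective {suc u} {suc v} (there u∈) (there v∈) eq with u ≟ᶠ v
      ... | yes u≡v = cong suc u≡v
      ... | no  u≢v = contradiction (compress-injective S (N[_] G u) (N[_] G v) eq)
        (locating (proj₁ (∈-select⁻ offLayer? u∈)) (proj₁ (∈-select⁻ offLayer? v∈)) u≢v)

  -- A solid code is locating-dominating, hence `a ≤ b`; enlarging an optimal `S` by `offLayer`
  -- bounds `b` from above. The additive form avoids truncated subtraction.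
  γDLD-bound : ∀ {a b} {G : Graph n} → a ≢ 0 → IsγLD G a → IsγDLD G b →
    a ≤ b × b + suc (a C ⌈ a /2⌉) ≤ 2 ^ a + a
  γDLD-bound {G = G} a≢0 ((S , ld , refl) , minLD) ((D , solid , refl) , minDLD) =
    minLD D (solid⇒locating G solid) , (begin
      ∣ D ∣ + suc (∣ S ∣ C half)
        ≤⟨ +-monoˡ-≤ (suc (∣ S ∣ C half)) (≤-trans (minDLD _ (S∪offLayer-solid ld half)) (∣p∪q∣≤∣p∣+∣q∣ S W)) ⟩
      ∣ S ∣ + ∣ W ∣ + suc (∣ S ∣ C half)
        ≡⟨ +-assoc ∣ S ∣ ∣ W ∣ _ ⟩
      ∣ S ∣ + (∣ W ∣ + suc (∣ S ∣ C half))
        ≡⟨ cong (∣ S ∣ +_) (+-suc ∣ W ∣ _) ⟩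
      ∣ S ∣ + (suc ∣ W ∣ + ∣ S ∣ C half)
        ≤⟨ +-monoʳ-≤ ∣ S ∣ (∣offLayer∣-bound ld half (k≢0 a≢0)) ⟩
      ∣ S ∣ + 2 ^ ∣ S ∣
        ≡⟨ +-comm ∣ S ∣ _ ⟩
      2 ^ ∣ S ∣ + ∣ S ∣ ∎)
    where
    open ≤-Reasoning
    half = ⌈ ∣ S ∣ /2⌉
    W = offLayer ld half
    k≢0 : ∀ {c} → c ≢ 0 → ⌈ c /2⌉ ≢ 0
    k≢0 {zero}        c≢0 _  = c≢0 refl
    k≢0 {suc zero}    _   ()
    k≢0 {suc (suc c)} _   ()

  -- Adding a vertex to the graph and to the code.

  module _ {G : Graph n} {H : Graph (suc n)}
    (adj-suc : ∀ u v → Graph.adj H (suc u) (suc v) ≡ Graph.adj G u v) where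

    private
      ∈I-suc⁺ : ∀ {D u x} → x ∈ I G D u → suc x ∈ I H (inside ∷ D) (suc u)
      ∈I-suc⁺ {u = u} x∈I with ∈I⁻ G {u = u} x∈I
      ... | inj₁ eq   , x∈D = ∈I⁺ H (inj₁ (trans (adj-suc u _) eq)) (there x∈D)
      ... | inj₂ refl , x∈D = ∈I⁺ H (inj₂ refl) (there x∈D)

      ∈I-suc⁻ : ∀ {D u x} → suc x ∈ I H (inside ∷ D) (suc u) → x ∈ I G D u
      ∈I-suc⁻ {u = u} x∈I with ∈I⁻ H {u = suc u} x∈I
      ... | inj₁ eq   , there x∈D = ∈I⁺ G (inj₁ (trans (sym (adj-suc u _)) eq)) x∈D
      ... | inj₂ refl , there x∈D = ∈I⁺ G (inj₂ refl) x∈D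

    -- Vertex `zero` is in the code, so no condition falls on it. Away from `zero` the traces are
    -- those in `G`, so an inclusion in `H` would restrict to one in `G`.
    solid-suc : ∀ {D} → IsSolidLocatingDominating G D → IsSolidLocatingDominating H (inside ∷ D)
    solid-suc {D} solid = record
      { nonempty       = zero , here
      ; dominating     = dominating′
      ; solid-locating = solid-locating′
      }
      where
      open IsSolidLocatingDominating solid
      dominating′ : ∀ {u} → u ∉ inside ∷ D → Nonempty (I H (inside ∷ D) u)
      dominating′ {zero}  u∉ = contradiction here u∉
      dominating′ {suc u} u∉ = let x , x∈I = dominating (u∉ ∘ there) in suc x , ∈I-suc⁺ {u = u} x∈I

      solid-locating′ : ∀ {u v} → u ∉ inside ∷ D → v ∉ inside ∷ D → u ≢ v →
                        I H (inside ∷ D) u ⊈ I H (inside ∷ D) v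
      solid-locating′ {zero}          u∉ v∉ u≢v _   = u∉ here
      solid-locating′ {suc u} {zero}  u∉ v∉ u≢v _   = v∉ here
      solid-locating′ {suc u} {suc v} u∉ v∉ u≢v sub = solid-locating (u∉ ∘ there) (v∉ ∘ there) (u≢v ∘ cong suc)
        λ x∈I → ∈I-suc⁻ {u = v} (sub (∈I-suc⁺ {u = u} x∈I))

  -- Incidence graphs of set families.

  incident : (Fin k → Subset a) → Fin k ⊎ Fin a → Fin k ⊎ Fin a → Bool
  incident F (inj₁ i) (inj₂ c) = Vec.lookup (F i) c
  incident F (inj₂ c) (inj₁ i) = Vec.lookup (F i) c
  incident F (inj₁ _) (inj₁ _) = false
  incident F (inj₂ _) (inj₂ _) = false

  incidence : (Fin k → Subset a) → Graph (k + a)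
  incidence {k} {a} F = record
    { adj      = λ u v → incident F (splitAt k u) (splitAt k v)
    ; adj-sym  = λ u v → incident-sym (splitAt k u) (splitAt k v)
    ; loopless = λ u → incident-irrefl (splitAt k u)
    }
    where
    incident-sym : ∀ x y → incident F x y ≡ incident F y x
    incident-sym (inj₁ _) (inj₁ _) = refl
    incident-sym (inj₁ _) (inj₂ _) = refl
    incident-sym (inj₂ _) (inj₁ _) = refl
    incident-sym (inj₂ _) (inj₂ _) = refl

    incident-irrefl : ∀ x → incident F x x ≡ false
    incident-irrefl (inj₁ _) = refl
    incident-irrefl (inj₂ _) = refl

  incidence-suc : (F : Fin (suc k) → Subset a) → ∀ u v →
    Graph.adj (incidence F) (suc u) (suc v) ≡ Graph.adj (incidence (F ∘ suc)) u v
  incidence-suc {k} F u v with splitAt k u | splitAt k v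
  ... | inj₁ _ | inj₁ _ = refl
  ... | inj₁ _ | inj₂ _ = refl
  ... | inj₂ _ | inj₁ _ = refl
  ... | inj₂ _ | inj₂ _ = refl

  module Incidence {k a : ℕ} (F : Fin k → Subset a) where

    G : Graph (k + a)
    G = incidence F

    set : Fin k → Fin (k + a)
    set i = i ↑ˡ a

    point : Fin a → Fin (k + a)
    point c = k ↑ʳ c

    data View : Fin (k + a) → Set where
      isSet   : ∀ i → View (set i)
      isPoint : ∀ c → View (point c)

    view : ∀ u → View u
    view u with splitAt k u in eq
    ... | inj₁ i = subst View (splitAt⁻¹-↑ˡ eq) (isSet i)
    ... | inj₂ c = subst View (splitAt⁻¹-↑ʳ eq) (isPoint c)

    set≢point : ∀ {i c} → set i ≢ point c
    set≢point {i} {c} eq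
      with () ← trans (sym (splitAt-↑ˡ k i a)) (trans (cong (splitAt k) eq) (splitAt-↑ʳ k a c))

    ∈I-set⁺ : ∀ {D i c} → c ∈ F i → point c ∈ D → point c ∈ I G D (set i)
    ∈I-set⁺ {i = i} {c} c∈Fi c∈D = ∈I⁺ G (inj₁ adjacent) c∈D
      where
      adjacent : incident F (splitAt k (set i)) (splitAt k (point c)) ≡ true
      adjacent rewrite splitAt-↑ˡ k i a | splitAt-↑ʳ k a c = []=⇒lookup c∈Fi

    -- A set is adjacent to points only and, being outside `D`, is not in its own trace.
    ∈I-set⁻ : ∀ {D i x} → set i ∉ D → x ∈ I G D (set i) → ∃[ c ] x ≡ point c × c ∈ F i × point c ∈ D
    ∈I-set⁻ {i = i} {x} i∉D x∈I with view x | ∈I⁻ G {u = set i} x∈I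
    ... | _         | inj₂ refl , x∈D = contradiction x∈D i∉D
    ... | isSet j   | inj₁ eq   , x∈D rewrite splitAt-↑ˡ k i a | splitAt-↑ˡ k j a with () ← eq
    ... | isPoint c | inj₁ eq   , x∈D rewrite splitAt-↑ˡ k i a | splitAt-↑ʳ k a c = c , refl , lookup⇒[]= c (F i) eq , x∈D

    points : Subset (k + a)
    points = ⊥ {k} Vec.++ ⊤ {a}

    ∣points∣ : ∣ points ∣ ≡ a
    ∣points∣ = size k
      where
      size : ∀ k → ∣ ⊥ {k} Vec.++ ⊤ {a} ∣ ≡ a
      size zero    = ∣⊤∣≡n a
      size (suc k) = size k

    point∈points : ∀ {c} → point c ∈ points
    point∈points {c} = lookup⇒[]= (point c) points (trans (lookup-++ʳ (⊥ {k}) ⊤ c) ([]=⇒lookup (∈⊤ {x = c})))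

    set∉points : ∀ {i} → set i ∉ points
    set∉points {i} i∈ = ∉⊥ (lookup⇒[]= i ⊥ (trans (sym (lookup-++ˡ (⊥ {k}) (⊤ {a}) i)) ([]=⇒lookup i∈)))

    points-dominating : (∀ i → Nonempty (F i)) → ∀ {u} → u ∉ points → Nonempty (I G points u)
    points-dominating ne {u} u∉ with view u
    ... | isSet i   = let c , c∈Fi = ne i in point c , ∈I-set⁺ c∈Fi point∈points
    ... | isPoint c = contradiction point∈points u∉

    -- The trace of `set i` on the points is a copy of `F i`.
    I-points⊆⇒F⊆ : ∀ {i j} → I G points (set i) ⊆ I G points (set j) → F i ⊆ F j
    I-points⊆⇒F⊆ {i} {j} sub {c} c∈Fi
      with d , eq , d∈Fj , _ ← ∈I-set⁻ set∉points (sub (∈I-set⁺ c∈Fi point∈points))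
      = subst (_∈ F j) (sym (↑ʳ-injective k c d eq)) d∈Fj

    module _ (0<a : 0 < a) (ne : ∀ i → Nonempty (F i)) where

      points-nonempty : Nonempty points
      points-nonempty = point (fromℕ< 0<a) , point∈points

      points-locating : (∀ {i j} → F i ≡ F j → i ≡ j) → IsLocatingDominating G points
      points-locating inj = record
        { nonempty = points-nonempty ; dominating = points-dominating ne ; locating = locating }
        where
        locating : ∀ {u v} → u ∉ points → v ∉ points → u ≢ v → I G points u ≢ I G points v
        locating {u} {v} u∉ v∉ u≢v eq with view u | view v
        ... | isPoint _ | _         = u∉ point∈points
        ... | isSet _   | isPoint _ = v∉ point∈points
        ... | isSet i   | isSet j   = u≢v (cong set (inj (⊆-antisym
                (I-points⊆⇒F⊆ (⊆-reflexive eq)) (I-points⊆⇒F⊆ (⊆-reflexive (sym eq))))))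

      points-solid : (∀ {i j} → F i ⊆ F j → i ≡ j) → IsSolidLocatingDominating G points
      points-solid antichain = record
        { nonempty = points-nonempty ; dominating = points-dominating ne ; solid-locating = solid-locating }
        where
        solid-locating : ∀ {u v} → u ∉ points → v ∉ points → u ≢ v → I G points u ⊈ I G points v
        solid-locating {u} {v} u∉ v∉ u≢v sub with view u | view v
        ... | isPoint _ | _         = u∉ point∈points
        ... | isSet _   | isPoint _ = v∉ point∈points
        ... | isSet i   | isSet j   = u≢v (cong set (antichain (I-points⊆⇒F⊆ sub)))

    module _ (s : Fin a → Fin k) (F∘s : ∀ c → F (s c) ≡ ⁅ c ⁆) {D : Subset (k + a)}
      (dominating : ∀ {u} → u ∉ D → Nonempty (I G D u)) where

      private
        Near : Fin a → Fin (k + a) → Set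
        Near c x = x ≡ set (s c) ⊎ x ≡ point c

        dominator : ∀ c → ∃[ x ] x ∈ D × Near c x
        dominator c with set (s c) ∈? D
        ... | yes s∈D = set (s c) , s∈D , inj₁ refl
        ... | no  s∉D with x , x∈I ← dominating s∉D with d , refl , d∈F , d∈D ← ∈I-set⁻ s∉D x∈I
          = point d , d∈D , inj₂ (cong point (x∈⁅y⁆⇒x≡y c (subst (d ∈_) (F∘s c) d∈F)))

        near-unique : ∀ {c d x y} → Near c x → Near d y → x ≡ y → c ≡ d
        near-unique (inj₁ refl) (inj₂ refl) eq = contradiction eq set≢point
        near-unique (inj₂ refl) (inj₁ refl) eq = contradiction (sym eq) set≢point
        near-unique (inj₂ refl) (inj₂ refl) eq = ↑ʳ-injective k _ _ eq
        near-unique {c} {d} (inj₁ refl) (inj₁ refl) eq = x∈⁅y⁆⇒x≡y d (subst (c ∈_) ⁅c⁆≡⁅d⁆ (x∈⁅x⁆ c))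
          where
          ⁅c⁆≡⁅d⁆ : ⁅ c ⁆ ≡ ⁅ d ⁆
          ⁅c⁆≡⁅d⁆ = trans (sym (F∘s c)) (trans (cong F (↑ˡ-injective a _ _ eq)) (F∘s d))

      -- The vertex `set (s c)` is pendant at `point c`. To dominate it, `D` must contain one of the
      -- two, and these pairs are disjoint for distinct `c`.
      a≤∣D∣ : a ≤ ∣ D ∣
      a≤∣D∣ = subst (_≤ ∣ D ∣) (∣⊤∣≡n a) (∣p∣≤∣q∣-injection ⊤ D
        (λ {c} _ → proj₁ (dominator c)) (λ {c} _ → proj₁ (proj₂ (dominator c)))
        (λ {c} {d} _ _ → near-unique (proj₂ (proj₂ (dominator c))) (proj₂ (proj₂ (dominator d)))))

    module _ {D : Subset (k + a)} (solid : IsSolidLocatingDominating G D) where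
      open IsSolidLocatingDominating solid

      private
        trace : Subset a
        trace = tabulate (λ c → Vec.lookup D (point c))

        ∈-trace⁺ : ∀ {c} → point c ∈ D → c ∈ trace
        ∈-trace⁺ = ∈-tabulate⁺ ∘ []=⇒lookup

        ∈-trace⁻ : ∀ {c} → c ∈ trace → point c ∈ D
        ∈-trace⁻ = lookup⇒[]= _ D ∘ ∈-tabulate⁻

        -- A point c outside D lies in no trace, so ⁅ c ⁆ is incomparable to the non-empty traces of the
        -- sets outside D: Sperner's theorem applies to all of ∁ D at once.
        shadow : Fin (k + a) → Subset a
        shadow u = [ (λ i → F i ∩ trace) , ⁅_⁆ ]′ (splitAt k u)

        antichain : ∀ {u v} → u ∉ D → v ∉ D → u ≢ v → shadow u ⊈ shadow v
        antichain {u} {v} u∉D v∉D u≢v sub with view u | view v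
        ... | isSet i | isSet j rewrite splitAt-↑ˡ k i a | splitAt-↑ˡ k j a = solid-locating u∉D v∉D u≢v I⊆I
          where
          -- The trace of a set outside `D` consists of points, so `F i ∩ trace` records all of it.
          I⊆I : I G D (set i) ⊆ I G D (set j)
          I⊆I x∈I with c , refl , c∈Fi , c∈D ← ∈I-set⁻ u∉D x∈I
            = ∈I-set⁺ (proj₁ (x∈p∩q⁻ (F j) trace (sub (x∈p∩q⁺ (c∈Fi , ∈-trace⁺ c∈D))))) c∈D
        -- By domination some point of `D` lies in `F i`; the inclusion makes it `c`, which is
        -- outside `D`.
        ... | isSet i | isPoint c rewrite splitAt-↑ˡ k i a | splitAt-↑ʳ k a c
          with x , x∈I ← dominating u∉D with d , refl , d∈Fi , d∈D ← ∈I-set⁻ u∉D x∈I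
          with refl ← x∈⁅y⁆⇒x≡y c (sub (x∈p∩q⁺ (d∈Fi , ∈-trace⁺ d∈D))) = v∉D d∈D
        ... | isPoint c | isSet j rewrite splitAt-↑ˡ k j a | splitAt-↑ʳ k a c
          = u∉D (∈-trace⁻ (proj₂ (x∈p∩q⁻ (F j) trace (sub (x∈⁅x⁆ c)))))
        ... | isPoint c | isPoint d rewrite splitAt-↑ʳ k a c | splitAt-↑ʳ k a d
          = u≢v (cong point (x∈⁅y⁆⇒x≡y d (sub (x∈⁅x⁆ c))))

      ∣∁D∣-bound : ∣ ∁ D ∣ ≤ a C ⌈ a /2⌉
      ∣∁D∣-bound = sperner shadow (∁ D) λ u∈ v∈ → antichain (x∈∁p⇒x∉p u∈) (x∈∁p⇒x∉p v∈)

      order-bound : k + a ≤ a C ⌈ a /2⌉ + ∣ D ∣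
      order-bound = begin
        k + a                        ≤⟨ m≤n+m∸n (k + a) ∣ D ∣ ⟩
        ∣ D ∣ + (k + a ∸ ∣ D ∣)      ≡⟨ cong (∣ D ∣ +_) (∣∁p∣≡n∸∣p∣ D) ⟨
        ∣ D ∣ + ∣ ∁ D ∣              ≤⟨ +-monoʳ-≤ ∣ D ∣ ∣∁D∣-bound ⟩
        ∣ D ∣ + a C ⌈ a /2⌉          ≡⟨ +-comm ∣ D ∣ _ ⟩
        a C ⌈ a /2⌉ + ∣ D ∣          ∎
        where open ≤-Reasoning

  open Incidence using (points; ∣points∣; points-locating; points-solid; a≤∣D∣; order-bound)

  -- Families with all singletons, and the intermediate values.

  -- The singletons occupy the last `a` indices, so composing with `suc` drops one of the `k` other
  -- members and keeps every singleton.
  record IsAdmissible (k : ℕ) (F : Fin (k + a) → Subset a) : Set where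
    field
      members-nonempty : ∀ i → Nonempty (F i)
      injective        : ∀ {i j} → F i ≡ F j → i ≡ j
      singletons       : ∀ c → F (k ↑ʳ c) ≡ ⁅ c ⁆

  module _ {F : Fin (k + a) → Subset a} (admissible : IsAdmissible k F) where
    open IsAdmissible admissible

    -- Distinct members have distinct traces on the points, so the points form a code; the pendant
    -- singletons make it minimum.
    admissible-γLD : 0 < a → IsγLD (incidence F) a
    admissible-γLD 0<a =
      (points F , points-locating F 0<a members-nonempty injective , ∣points∣ F) ,
      λ D ld → a≤∣D∣ F (k ↑ʳ_) singletons (IsLocatingDominating.dominating ld)

  admissible-suc : {F : Fin (suc k + a) → Subset a} → IsAdmissible (suc k) F → IsAdmissible k (F ∘ suc)
  admissible-suc admissible = record
    { members-nonempty = members-nonempty ∘ suc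
    ; injective        = suc-injectiveᶠ ∘ injective
    ; singletons       = singletons
    } where open IsAdmissible admissible

  Realizable : ℕ → ℕ → Set
  Realizable a b = ∃[ n ] ∃[ G ] (IsγLD {n} G a × IsγDLD {n} G b)

  -- Deleting the members of F one by one, down to the singletons, lowers γDLD by at most one at a
  -- time (solid-suc), so that every value down to a is attained.
  descend : ∀ {a b} → 0 < a → a ≤ b → ∀ k {F : Fin (k + a) → Subset a} → IsAdmissible k F →
    (∀ D → IsSolidLocatingDominating (incidence F) D → b ≤ ∣ D ∣) → Realizable a b
  descend {a} {b} 0<a a≤b zero {F} admissible bound =
    _ , incidence F , admissible-γLD admissible 0<a , subst (IsγDLD _) (≤-antisym a≤b b≤a) γDLD
    where
    open IsAdmissible admissible
    -- Distinct singletons are incomparable, so the points are a solid code of size `a`, which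
    -- forces `b` to equal `a`.
    solid : IsSolidLocatingDominating (incidence F) (points F)
    solid = points-solid F 0<a members-nonempty λ {i} {j} sub →
      x∈⁅y⁆⇒x≡y j (subst (i ∈_) (singletons j) (sub (subst (i ∈_) (sym (singletons i)) (x∈⁅x⁆ i))))

    b≤a : b ≤ a
    b≤a = subst (b ≤_) (∣points∣ F) (bound _ solid)

    γDLD : IsγDLD (incidence F) a
    γDLD = (points F , solid , ∣points∣ F) , λ D sol → ≤-trans a≤b (bound D sol)
  descend {a} {b} 0<a a≤b (suc k) {F} admissible bound
    -- If the smaller graph has no solid code below size `b`, the bound passes to it. Otherwise such
    -- a code together with vertex `zero` has size at most `b`, hence exactly `b` by the bound for
    -- the present graph.
    with anySubset? (λ D → solid? (incidence (F ∘ suc)) D ×-dec (suc ∣ D ∣ ≤? b))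
  ... | no  none = descend 0<a a≤b k (admissible-suc admissible)
                     λ D sol → ≮⇒≥ (λ lt → none (D , sol , lt))
  ... | yes (D , sol , lt) = _ , incidence F , admissible-γLD admissible 0<a ,
      (inside ∷ D , sol′ , ≤-antisym lt (bound _ sol′)) , bound
    where
    sol′ : IsSolidLocatingDominating (incidence F) (inside ∷ D)
    sol′ = solid-suc (incidence-suc F) sol

  -- The family of all non-empty subsets.

  module _ (a : ℕ) where

    small : List (Subset a)
    small = ⊥ ∷ List.map ⁅_⁆ (allFin a)

    open DecMembership (Vec-≡-dec {n = a} _≟ᵇ_) using () renaming (_∈?_ to _∈ˡ?_)

    large : List (Subset a)
    large = filter (¬? ∘ (_∈ˡ? small)) (subsets a)

    -- Every subset is in `large` or in `small`, and `small` has `a + 1` entries.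
    2^a≤ : 2 ^ a ≤ suc (length large + a)
    2^a≤ = begin
      2 ^ a
        ≡⟨ length-subsets a ⟨
      length (subsets a)
        ≤⟨ Unique-length-≤ (subsets-unique a) (λ {p} _ → covered p) ⟩
      length (large List.++ small)
        ≡⟨ Listₚ.length-++ large ⟩
      length large + suc (length (List.map ⁅_⁆ (allFin a)))
        ≡⟨ cong (λ l → length large + suc l)
             (trans (Listₚ.length-map ⁅_⁆ (allFin a)) (Listₚ.length-tabulate id)) ⟩
      length large + suc a
        ≡⟨ +-suc (length large) a ⟩
      suc (length large + a) ∎
      where
      open ≤-Reasoning
      covered : ∀ p → p ∈ˡ large List.++ small
      covered p with p ∈ˡ? small
      ... | yes p∈ = ∈ˡ.∈-++⁺ʳ large p∈
      ... | no  p∉ = ∈ˡ.∈-++⁺ˡ (∈ˡ.∈-filter⁺ (¬? ∘ (_∈ˡ? small)) (∈-subsets p) p∉)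

    family : Fin (length large + a) → Subset a
    family = [ lookup large , ⁅_⁆ ]′ ∘ splitAt (length large)

    family-admissible : IsAdmissible (length large) family
    family-admissible = record
      { members-nonempty = members-nonempty
      ; injective        = λ {i} {j} → injective i j
      ; singletons       = λ c → cong [ lookup large , ⁅_⁆ ]′ (splitAt-↑ʳ (length large) a c)
      }
      where
      ∉small : ∀ i → ¬ lookup large i ∈ˡ small
      ∉small i = proj₂ (∈ˡ.∈-filter⁻ (¬? ∘ (_∈ˡ? small)) {xs = subsets a} (∈ˡ.∈-lookup {xs = large} i))

      ⁅_⁆∈small : ∀ c → ⁅ c ⁆ ∈ˡ small
      ⁅ c ⁆∈small = there (∈ˡ.∈-map⁺ ⁅_⁆ (∈ˡ.∈-allFin c))

      large-unique : Unique large
      large-unique = Uniqueₚ.filter⁺ (¬? ∘ (_∈ˡ? small)) (subsets-unique a)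

      members-nonempty : ∀ i → Nonempty (family i)
      members-nonempty i with splitAt (length large) i
      ... | inj₂ c = c , x∈⁅x⁆ c
      ... | inj₁ j with nonempty? (lookup large j)
      ...   | yes ne = ne
      ...   | no  em = contradiction (here (Empty-unique em)) (∉small j)

      injective : ∀ i j → family i ≡ family j → i ≡ j
      injective i j eq with splitAt (length large) i in eqᵢ | splitAt (length large) j in eqⱼ
      ... | inj₁ x | inj₁ y = trans (sym (splitAt⁻¹-↑ˡ eqᵢ))
        (trans (cong (_↑ˡ a) (lookup-injective large-unique x y eq)) (splitAt⁻¹-↑ˡ eqⱼ))
      ... | inj₁ x | inj₂ d = contradiction (subst (_∈ˡ small) (sym eq) ⁅ d ⁆∈small) (∉small x)
      ... | inj₂ c | inj₁ y = contradiction (subst (_∈ˡ small) eq ⁅ c ⁆∈small) (∉small y)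
      ... | inj₂ c | inj₂ d = trans (sym (splitAt⁻¹-↑ʳ eqᵢ))
        (trans (cong (length large ↑ʳ_) (x∈⁅y⁆⇒x≡y d (subst (c ∈_) eq (x∈⁅x⁆ c)))) (splitAt⁻¹-↑ʳ eqⱼ))

  -- The graph of the full family has at least `2 ^ a - 1 + a` vertices, of which a solid code omits
  -- at most `a C ⌈ a /2⌉`. So the upper bound on `b` says that no solid code is smaller than `b`,
  -- and `descend` can start here.
  realize : ∀ {a b} → 0 < a → a ≤ b → b + suc (a C ⌈ a /2⌉) ≤ 2 ^ a + a → Realizable a b
  realize {a} {b} 0<a a≤b b≤ = descend 0<a a≤b (length (large a)) (family-admissible a) λ D solid →
    +-cancelˡ-≤ (suc (a C ⌈ a /2⌉)) b ∣ D ∣ (begin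
      suc (a C ⌈ a /2⌉) + b                  ≡⟨ +-comm (suc (a C ⌈ a /2⌉)) b ⟩
      b + suc (a C ⌈ a /2⌉)                  ≤⟨ b≤ ⟩
      2 ^ a + a                              ≤⟨ +-monoˡ-≤ a (2^a≤ a) ⟩
      suc (length (large a) + a + a)         ≤⟨ s≤s (order-bound (family a) solid) ⟩
      suc (a C ⌈ a /2⌉) + ∣ D ∣              ∎)
    where open ≤-Reasoning

  -- The bounds over the integers.

  private
    rearrange : ∀ x c b a → (x ℤ.- ℤ.1ℤ ℤ.- c) ℤ.- (b ℤ.- a) ≡ (x ℤ.+ a) ℤ.- (b ℤ.+ (ℤ.1ℤ ℤ.+ c))
    rearrange = solve-∀

  -- Both forms of the upper bound have the same right side minus left side, so each says that this
  -- one integer is non-negative.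
  ℕ-bounds⇔ℤ-bounds : ∀ a b c x → (a ≤ b × b + suc c ≤ x + a) ⇔
    (ℤ.0ℤ ℤ.≤ ℤ.+ b ℤ.- ℤ.+ a × ℤ.+ b ℤ.- ℤ.+ a ℤ.≤ ℤ.+ x ℤ.- ℤ.1ℤ ℤ.- ℤ.+ c)
  ℕ-bounds⇔ℤ-bounds a b c x = mk⇔
    (λ (a≤b , le) → ℤₚ.i≤j⇒0≤j-i (ℤ.+≤+ a≤b) ,
      ℤₚ.0≤i-j⇒j≤i (subst (ℤ.0ℤ ℤ.≤_) (sym difference) (ℤₚ.i≤j⇒0≤j-i (ℤ.+≤+ le))))
    (λ (0≤ , le) → ℤₚ.drop‿+≤+ (ℤₚ.0≤i-j⇒j≤i 0≤) ,
      ℤₚ.drop‿+≤+ (ℤₚ.0≤i-j⇒j≤i (subst (ℤ.0ℤ ℤ.≤_) difference (ℤₚ.i≤j⇒0≤j-i le))))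
    where
    difference : (ℤ.+ x ℤ.- ℤ.1ℤ ℤ.- ℤ.+ c) ℤ.- (ℤ.+ b ℤ.- ℤ.+ a) ≡ ℤ.+ (x + a) ℤ.- ℤ.+ (b + suc c)
    difference = rearrange (ℤ.+ x) (ℤ.+ c) (ℤ.+ b) (ℤ.+ a)

  realizable⇔ : ∀ {a b} → 0 < a → Realizable a b ⇔ (a ≤ b × b + suc (a C ⌈ a /2⌉) ≤ 2 ^ a + a)
  realizable⇔ 0<a = mk⇔
    (λ (_ , _ , γLD , γDLD) → γDLD-bound (>⇒≢ 0<a) γLD γDLD)
    (λ (a≤b , le) → realize 0<a a≤b le)

open import Data.Integer.Base using (+_; _-_; 0ℤ; 1ℤ; _≤_)
mainTheorem20 : ∀ (a b : ℕ) → 0 < a → 0 < b →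
    (∃[ n ] ∃[ G ] (IsγLD {n} G a × IsγDLD {n} G b))
    ⇔ (0ℤ ≤ + b - + a × + b - + a ≤ + (2 ^ a) - 1ℤ - + (a C ⌈ a /2⌉))
mainTheorem20 a b 0<a _ =
  ⇔-trans (Codes.realizable⇔ 0<a) (Codes.ℕ-bounds⇔ℤ-bounds a b (a C ⌈ a /2⌉) (2 ^ a))
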